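{- Let $\lambda(\bar y)=\exists x.\,\lambda_m(x,\bar y)$ be a formula of Linear Rational Arithmetic, with $\lambda_m$ quantifier-free, in negation normal form, and such that $x$ appears in $\lambda_m$ only in literals of the form $\ell<x$, $x<u$ and $x=e$ with $\ell,u,e$ being $x$-free terms. Then $\mathrm{LRAProj}_\lambda$ is a Model Based Projection for $\lambda$.
   Context: **Model Based Projection.** Let $\mathit{Th}$ be a theory and $\lambda(\bar y)=\exists\bar x.\,\lambda_m(\bar x,\bar y)$ with $\lambda_m$ quantifier-free. A function $\mathrm{Proj}_\lambda$ from models (modulo $\mathit{Th}$, including values for the variables) of $\lambda_m$ to quantifier-free formulas over $\bar y$ is a Model Based Projection (for $\lambda$) iff (i) it has a finite image, (ii) $\lambda\equiv\bigvee_{M\models\lambda_m}\mathrm{Proj}_\lambda(M)$ (equivalence modulo $\mathit{Th}$), and (iii) $M\models\mathrm{Proj}_\lambda(M)$ for every model $M$ of $\lambda_m$. Here $\mathit{Th}$ is Linear Rational Arithmetic (LRA). **Virtual substitutions** (Loos–Weispfenning). Let $\mathrm{lits}(\lambda)$ be the set of literals of $\lambda$. For $t$ of the form $e$, $\ell+\epsilon$ or $-\infty$ (where $e$ is an $x$-free term from a literal $x=e$, $\ell$ an $x$-free term from a literal $\ell<x$, and $\epsilon$, $\infty$ are formal symbols), $\lambda_m[t]$ is the result of replacing every literal of $\lambda_m$ containing $x$ as follows: - $t=e$: $(x=e)\mapsto\top$; $(\ell<x)\mapsto(\ell<e)$; $(x<u)\mapsto(e<u)$; (and $(x=e')\mapsto(e=e')$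 for other equality literals, by ordinary substitution); - $t=\ell+\epsilon$: $(x=e)\mapsto\bot$; $(\ell'<x)\mapsto(\ell'\le\ell)$; $(x<u)\mapsto(\ell<u)$; - $t=-\infty$: $(x=e)\mapsto\bot$; $(\ell<x)\mapsto\bot$; $(x<u)\mapsto\top$. **Definition of $\mathrm{LRAProj}_\lambda$.** For $M\models\lambda_m$: - $\mathrm{LRAProj}_\lambda(M)=\lambda_m[e]$ if $(x=e)\in\mathrm{lits}(\lambda)$ and $M\models x=e$; - else $\mathrm{LRAProj}_\lambda(M)=\lambda_m[\ell+\epsilon]$ if $(\ell<x)\in\mathrm{lits}(\lambda)$, $M\models\ell<x$, and for all $(\ell'<x)\in\mathrm{lits}(\lambda)$, $M\models((\ell'<x)\Rightarrow(\ell'\le\ell))$; - otherwise $\mathrm{LRAProj}_\lambda(M)=\lambda_m[-\infty]$. Ties between several eligible $e$ or several eligible $\ell$ are broken by a fixed syntactic ordering on terms. -}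

module Defs where

open import Data.Bool.Base using (if_then_else_)
open import Data.Empty using (⊥)
open import Data.Fin.Base using (Fin; zero; suc)
open import Data.List.Base using (List; []; _∷_; _++_; filter; mapMaybe)
open import Data.List.Membership.Propositional using (_∈_)
open import Data.List.Relation.Unary.All as All using (All)
import Data.List.Extrema as Extrema
open import Data.Maybe.Base using (Maybe; just; nothing)
open import Data.Nat.Base using (ℕ; suc; _+_)
open import Data.Product.Base using (∃; Σ; _×_; _,_)
open import Data.Rational.Base as ℚ using (ℚ)
import Data.Rational.Properties as ℚ
open import Data.Sum.Base using (_⊎_)
open import Data.Unit.Base using (⊤)
open import Data.Vec.Base as Vec using (Vec; []; _∷_)
open import Function.Bundles using (_⇔_)
open import Relation.Binary.Bundles using (TotalOrder)
open import Relation.Binary.Core using (Rel)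
open import Relation.Binary.PropositionalEquality.Core using (_≡_)
open import Relation.Binary.Structures using (IsDecTotalOrder)
open import Relation.Nullary.Decidable.Core using (Dec; yes; no; does; ¬?; _×-dec_; _⊎-dec_; _→-dec_)
open import Relation.Nullary.Negation.Core using (¬_)

infixl 6 _⊕_
infixr 7 _⊙_
infix  5 _<′_ _≤′_ _=′_
infix  4 ¬′_
infixr 3 _∧′_
infixr 2 _∨′_
infix  1 _⊨_ _⊨?_

------------------------------------------------------------------------
-- Quantifier-free linear rational arithmetic

data Term (n : ℕ) : Set where
  var   : Fin n → Term n
  const : ℚ → Term n
  _⊕_   : Term n → Term n → Term n
  _⊙_   : ℚ → Term n → Term n

data Formula (n : ℕ) : Set where
  ⊤′ ⊥′          : Formula n
  _<′_ _≤′_ _=′_ : Term n → Term n → Formula n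
  ¬′_            : Formula n → Formula n
  _∧′_ _∨′_      : Formula n → Formula n → Formula n

-- A model modulo LRA is a rational valuation of the variables.

Model : ℕ → Set
Model n = Vec ℚ n

⟦_⟧ : ∀ {n} → Term n → Model n → ℚ
⟦ var i ⟧   M = Vec.lookup M i
⟦ const q ⟧ M = q
⟦ s ⊕ t ⟧   M = ⟦ s ⟧ M ℚ.+ ⟦ t ⟧ M
⟦ q ⊙ t ⟧   M = q ℚ.* ⟦ t ⟧ M

_⊨_ : ∀ {n} → Model n → Formula n → Set
M ⊨ ⊤′     = ⊤
M ⊨ ⊥′     = ⊥
M ⊨ s <′ t = ⟦ s ⟧ M ℚ.< ⟦ t ⟧ M
M ⊨ s ≤′ t = ⟦ s ⟧ M ℚ.≤ ⟦ t ⟧ M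
M ⊨ s =′ t = ⟦ s ⟧ M ≡ ⟦ t ⟧ M
M ⊨ ¬′ φ   = ¬ (M ⊨ φ)
M ⊨ φ ∧′ ψ = (M ⊨ φ) × (M ⊨ ψ)
M ⊨ φ ∨′ ψ = (M ⊨ φ) ⊎ (M ⊨ ψ)

_⊨?_ : ∀ {n} (M : Model n) (φ : Formula n) → Dec (M ⊨ φ)
M ⊨? ⊤′     = yes _
M ⊨? ⊥′     = no λ ()
M ⊨? s <′ t = ⟦ s ⟧ M ℚ.<? ⟦ t ⟧ M
M ⊨? s ≤′ t = ⟦ s ⟧ M ℚ.≤? ⟦ t ⟧ M
M ⊨? s =′ t = ⟦ s ⟧ M ℚ.≟ ⟦ t ⟧ M
M ⊨? ¬′ φ   = ¬? (M ⊨? φ)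
M ⊨? φ ∧′ ψ = (M ⊨? φ) ×-dec (M ⊨? ψ)
M ⊨? φ ∨′ ψ = (M ⊨? φ) ⊎-dec (M ⊨? ψ)

------------------------------------------------------------------------
-- Model based projection

-- The first m variables of λₘ are x̄ and the last n are ȳ, so that
-- λ(ȳ) = ∃ x̄. λₘ is the predicate  λ ys → ∃ λ xs → xs ++ ys ⊨ λₘ.
-- The satisfaction proof is irrelevant: Proj depends on the model only.

Projection : ∀ m n → Formula (m + n) → Set
Projection m n λₘ =
  (xs : Vec ℚ m) (ys : Vec ℚ n) → .(xs Vec.++ ys ⊨ λₘ) → Formula n

-- "Finite image" is expressed by a list containing every value of Proj.
-- The disjunction over all models of λₘ is expressed semantically, as an
-- existential quantification over the models.

record IsMBP {m n} (λₘ : Formula (m + n)) (Proj : Projection m n λₘ) : Set where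
  field
    finite-image : ∃ λ (φs : List (Formula n)) →
      ∀ xs ys (M⊨λₘ : xs Vec.++ ys ⊨ λₘ) → Proj xs ys M⊨λₘ ∈ φs
    equivalent : ∀ ys →
      (∃ λ (xs : Vec ℚ m) → xs Vec.++ ys ⊨ λₘ) ⇔
      (∃ λ (xs′ : Vec ℚ m) → ∃ λ (ys′ : Vec ℚ n) →
        Σ (xs′ Vec.++ ys′ ⊨ λₘ) λ M⊨λₘ → ys ⊨ Proj xs′ ys′ M⊨λₘ)
    satisfied : ∀ xs ys (M⊨λₘ : xs Vec.++ ys ⊨ λₘ) → ys ⊨ Proj xs ys M⊨λₘ

------------------------------------------------------------------------
-- Negation normal form and admissible literals

data IsAtom {n} : Formula n → Set where
  lt : ∀ s t → IsAtom (s <′ t)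
  le : ∀ s t → IsAtom (s ≤′ t)
  eq : ∀ s t → IsAtom (s =′ t)

data IsLiteral {n} : Formula n → Set where
  pos : ∀ {φ} → IsAtom φ → IsLiteral φ
  neg : ∀ {φ} → IsAtom φ → IsLiteral (¬′ φ)

-- NNF P φ: φ is in negation normal form and all its literals satisfy P,
-- where P is some predicate on literals.

data NNF {n} (P : Formula n → Set) : Formula n → Set where
  true  : NNF P ⊤′
  false : NNF P ⊥′
  lit   : ∀ {φ} → P φ → NNF P φ
  _and_ : ∀ {φ ψ} → NNF P φ → NNF P ψ → NNF P (φ ∧′ ψ)
  _or_  : ∀ {φ ψ} → NNF P φ → NNF P ψ → NNF P (φ ∨′ ψ)

lits : ∀ {n} {P : Formula n → Set} {φ} → NNF P φ → List (∃ P)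
lits true      = []
lits false     = []
lits (lit p)   = (_ , p) ∷ []
lits (d and e) = lits d ++ lits e
lits (d or e)  = lits d ++ lits e

-- The eliminated variable x is variable zero; the x-free terms and formulas
-- over x , ȳ are the weakenings of those over ȳ.

x : ∀ {n} → Term (suc n)
x = var zero

↑ₜ : ∀ {n} → Term n → Term (suc n)
↑ₜ (var i)   = var (suc i)
↑ₜ (const q) = const q
↑ₜ (s ⊕ t)   = ↑ₜ s ⊕ ↑ₜ t
↑ₜ (q ⊙ t)   = q ⊙ ↑ₜ t

↑ : ∀ {n} → Formula n → Formula (suc n)
↑ ⊤′       = ⊤′
↑ ⊥′       = ⊥′
↑ (s <′ t) = ↑ₜ s <′ ↑ₜ t
↑ (s ≤′ t) = ↑ₜ s ≤′ ↑ₜ t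
↑ (s =′ t) = ↑ₜ s =′ ↑ₜ t
↑ (¬′ φ)   = ¬′ ↑ φ
↑ (φ ∧′ ψ) = ↑ φ ∧′ ↑ ψ
↑ (φ ∨′ ψ) = ↑ φ ∨′ ↑ ψ

data XLiteral {n} : Formula (suc n) → Set where
  free  : ∀ {φ : Formula n} → IsLiteral φ → XLiteral (↑ φ)
  lower : (ℓ : Term n) → XLiteral (↑ₜ ℓ <′ x)
  upper : (u : Term n) → XLiteral (x <′ ↑ₜ u)
  equal : (e : Term n) → XLiteral (x =′ ↑ₜ e)

lowers : ∀ {n} {λₘ : Formula (suc n)} → NNF XLiteral λₘ → List (Term n)
lowers d = mapMaybe (λ { (_ , lower ℓ) → just ℓ ; _ → nothing }) (lits d)

equals : ∀ {n} {λₘ : Formula (suc n)} → NNF XLiteral λₘ → List (Term n)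
equals d = mapMaybe (λ { (_ , equal e) → just e ; _ → nothing }) (lits d)

------------------------------------------------------------------------
-- Virtual substitution and LRAProj

data VTerm (n : ℕ) : Set where
  exact : Term n → VTerm n
  _+ε   : Term n → VTerm n
  -∞    : VTerm n

-- The parameter is the fixed syntactic ordering on terms that breaks ties;
-- it also decides syntactic equality.

module _ {n c} {_≼_ : Rel (Term n) c} (O : IsDecTotalOrder _≡_ _≼_) where

  open IsDecTotalOrder O using (_≟_; isTotalOrder)

  private
    totalOrder : TotalOrder _ _ _
    totalOrder = record { isTotalOrder = isTotalOrder }

  substLit : {φ : Formula (suc n)} → XLiteral φ → VTerm n → Formula n
  substLit (free {φ} _) _          = φ
  substLit (lower ℓ)    (exact e)  = ℓ <′ e
  substLit (upper u)    (exact e)  = e <′ u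
  substLit (equal e′)   (exact e)  = if does (e′ ≟ e) then ⊤′ else e =′ e′
  substLit (lower ℓ′)   (ℓ +ε)     = ℓ′ ≤′ ℓ
  substLit (upper u)    (ℓ +ε)     = ℓ <′ u
  substLit (equal e)    (ℓ +ε)     = ⊥′
  substLit (lower ℓ)    -∞         = ⊥′
  substLit (upper u)    -∞         = ⊤′
  substLit (equal e)    -∞         = ⊥′

  _[_] : {φ : Formula (suc n)} → NNF XLiteral φ → VTerm n → Formula n
  true      [ t ] = ⊤′
  false     [ t ] = ⊥′
  lit l     [ t ] = substLit l t
  (d and e) [ t ] = d [ t ] ∧′ e [ t ]
  (d or e)  [ t ] = d [ t ] ∨′ e [ t ]

  least : List (Term n) → Maybe (Term n)
  least []       = nothing
  least (t ∷ ts) = just (Extrema.min totalOrder t ts)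

  module _ {λₘ : Formula (suc n)} (d : NNF XLiteral λₘ) (M : Model (suc n)) where

    eligibleEquals : List (Term n)
    eligibleEquals = filter (λ e → M ⊨? x =′ ↑ₜ e) (equals d)

    eligibleLowers : List (Term n)
    eligibleLowers = filter
      (λ ℓ → (M ⊨? ↑ₜ ℓ <′ x) ×-dec
             All.all? (λ ℓ′ → (M ⊨? ↑ₜ ℓ′ <′ x) →-dec (M ⊨? ↑ₜ ℓ′ ≤′ ↑ₜ ℓ)) (lowers d))
      (lowers d)

    testPoint : VTerm n
    testPoint with least eligibleEquals | least eligibleLowers
    ... | just e  | _       = exact e
    ... | nothing | just ℓ  = ℓ +ε
    ... | nothing | nothing = -∞

  LRAProj : {λₘ : Formula (suc n)} → NNF XLiteral λₘ → Projection 1 n λₘ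
  LRAProj d xs ys _ = d [ testPoint d (xs Vec.++ ys) ]

-- A virtual term t stands for a germ of values of x: the point e, the points just above ℓ, or all
-- sufficiently small points. The formula λₘ[t] implies that λₘ holds throughout this germ; germs
-- are closed under intersection and nonempty, so λₘ[t] implies ∃x. λₘ for every t whatsoever.
-- Conversely the test point chosen from a model M is such that every literal of λₘ true in M stays
-- true under the substitution; as λₘ is in negation normal form, M satisfies λₘ[t].

module Submission where

open import Defs
open import Data.List.Base using (List; []; _∷_; _++_; filter; map; mapMaybe)
import Data.List.Extrema as Extrema
open import Data.List.Membership.Propositional using (_∈_)
open import Data.List.Membership.Propositional.Properties using (∈-++⁺ˡ; ∈-++⁺ʳ; ∈-map⁺; ∈-filter⁺; ∈-filter⁻)
open import Data.List.Relation.Unary.All as All using (All)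
open import Data.List.Relation.Unary.Any as Any using (here; there)
open import Data.List.Relation.Unary.Any.Properties using (mapMaybe⁺)
open import Data.Maybe.Base using (Maybe; just; nothing)
import Data.Maybe.Relation.Unary.Any as Maybe
open import Data.Nat.Base using (ℕ; suc)
open import Data.Product.Base using (∃; _×_; _,_)
open import Data.Rational.Base as ℚ using (ℚ; 0ℚ; 1ℚ)
import Data.Rational.Properties as ℚ
open import Data.Sum.Base using (_⊎_; inj₁; inj₂; [_,_]′)
open import Data.Unit.Base using (tt)
open import Data.Vec.Base as Vec using ([]; _∷_)
open import Function.Base using (id; _∘_)
open import Function.Bundles using (mk⇔)
open import Level using (Level)
open import Relation.Binary.Bundles using (TotalOrder; DecTotalOrder)
open import Relation.Binary.Core using (Rel)
open import Relation.Binary.PropositionalEquality.Core using (_≡_; refl; sym; trans; cong; cong₂; subst)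
open import Relation.Binary.Structures using (IsDecTotalOrder)
open import Relation.Nullary.Decidable.Core using (yes; no)
open import Relation.Nullary.Negation.Core using (¬_)
open import Relation.Unary using (Pred; Decidable; _∩_)

open Extrema (DecTotalOrder.totalOrder ℚ.≤-decTotalOrder)
  using (argmax; argmax-sel; f[⊥]≤f[argmax]; f[xs]≤f[argmax])

private
  variable
    a p : Level
    A B : Set a
    n : ℕ

p<p+1 : ∀ p → p ℚ.< p ℚ.+ 1ℚ
p<p+1 p = subst (ℚ._< p ℚ.+ 1ℚ) (ℚ.+-identityʳ p) (ℚ.+-monoʳ-< p (ℚ.positive⁻¹ 1ℚ))

p-1<p : ∀ p → p ℚ.- 1ℚ ℚ.< p
p-1<p p = subst (p ℚ.- 1ℚ ℚ.<_) (ℚ.+-identityʳ p) (ℚ.+-monoʳ-< p (ℚ.negative⁻¹ (ℚ.- 1ℚ)))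

⊓-glb-< : ∀ {p q r} → p ℚ.< q → p ℚ.< r → p ℚ.< q ℚ.⊓ r
⊓-glb-< {p} {q} {r} p<q p<r with ℚ.⊓-sel q r
... | inj₁ q⊓r≡q = subst (p ℚ.<_) (sym q⊓r≡q) p<q
... | inj₂ q⊓r≡r = subst (p ℚ.<_) (sym q⊓r≡r) p<r

∈-mapMaybe⁺ : (f : A → Maybe B) {v : A} {w : B} {vs : List A} →
              f v ≡ just w → v ∈ vs → w ∈ mapMaybe f vs
∈-mapMaybe⁺ f fv≡w v∈vs = mapMaybe⁺ f _ (go v∈vs)
  where
  go : ∀ {us} → _ ∈ us → Any.Any (Maybe.Any (_ ≡_)) (map f us)
  go (here refl) = here (subst (Maybe.Any _) (sym fv≡w) (Maybe.just refl))
  go (there v∈us) = there (go v∈us)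

filter≡[]⇒¬ : {P : Pred A p} (P? : Decidable P) {vs : List A} →
              filter P? vs ≡ [] → ∀ {v} → v ∈ vs → ¬ P v
filter≡[]⇒¬ P? none v∈vs pv with subst (_ ∈_) none (∈-filter⁺ P? v∈vs pv)
... | ()

∃-argmax : (f : A → ℚ) {v : A} {vs : List A} → v ∈ vs →
           ∃ λ m → m ∈ vs × ∀ {w} → w ∈ vs → f w ℚ.≤ f m
∃-argmax f {vs = u ∷ us} _ = m , m∈vs , bound
  where
  -- The head `u` is the default value of `argmax`; since it belongs to the list itself, the
  -- maximiser is a member in either case of `argmax-sel`.
  m = argmax f u us
  m∈vs = [ here , there ]′ (argmax-sel f u us)
  bound : ∀ {w} → w ∈ u ∷ us → f w ℚ.≤ f m
  bound (here refl)  = f[⊥]≤f[argmax] {f = f} u us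
  bound (there w∈us) = All.lookup (f[xs]≤f[argmax] {f = f} u us) w∈us

⟦↑ₜ⟧ : ∀ (t : Term n) {q ys} → ⟦ ↑ₜ t ⟧ (q ∷ ys) ≡ ⟦ t ⟧ ys
⟦↑ₜ⟧ (var i)   = refl
⟦↑ₜ⟧ (const q) = refl
⟦↑ₜ⟧ (s ⊕ t)   = cong₂ ℚ._+_ (⟦↑ₜ⟧ s) (⟦↑ₜ⟧ t)
⟦↑ₜ⟧ (q ⊙ t)   = cong (q ℚ.*_) (⟦↑ₜ⟧ t)

-- Equality of types, rather than a pair of implications, lets every connective, negation included,
-- go through by congruence, and lets `subst id` transport in both directions.
⊨↑ : ∀ (φ : Formula n) {q ys} → (q ∷ ys ⊨ ↑ φ) ≡ (ys ⊨ φ)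
⊨↑ ⊤′       = refl
⊨↑ ⊥′       = refl
⊨↑ (s <′ t) = cong₂ ℚ._<_ (⟦↑ₜ⟧ s) (⟦↑ₜ⟧ t)
⊨↑ (s ≤′ t) = cong₂ ℚ._≤_ (⟦↑ₜ⟧ s) (⟦↑ₜ⟧ t)
⊨↑ (s =′ t) = cong₂ _≡_ (⟦↑ₜ⟧ s) (⟦↑ₜ⟧ t)
⊨↑ (¬′ φ)   = cong ¬_ (⊨↑ φ)
⊨↑ (φ ∧′ ψ) = cong₂ _×_ (⊨↑ φ) (⊨↑ ψ)
⊨↑ (φ ∨′ ψ) = cong₂ _⊎_ (⊨↑ φ) (⊨↑ ψ)

-- The bound b witnesses "for all q sufficiently close to t".
Near : VTerm n → Model n → (ℚ → Set) → Set
Near (exact e) ys P = P (⟦ e ⟧ ys)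
Near (ℓ +ε)    ys P = ∃ λ b → ⟦ ℓ ⟧ ys ℚ.< b × ∀ q → ⟦ ℓ ⟧ ys ℚ.< q → q ℚ.< b → P q
Near -∞        ys P = ∃ λ b → ∀ q → q ℚ.< b → P q

module _ {P Q : ℚ → Set} where

  Near-map : ∀ (t : VTerm n) {ys} → (∀ {q} → P q → Q q) → Near t ys P → Near t ys Q
  Near-map (exact e) f Pe            = f Pe
  Near-map (ℓ +ε)    f (b , ℓ<b , h) = b , ℓ<b , λ q ℓ<q q<b → f (h q ℓ<q q<b)
  Near-map -∞        f (b , h)       = b , λ q q<b → f (h q q<b)

  Near-∩ : ∀ (t : VTerm n) {ys} → Near t ys P → Near t ys Q → Near t ys (P ∩ Q)
  Near-∩ (exact e) Pe Qe = Pe , Qe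
  Near-∩ (ℓ +ε) (b , ℓ<b , hP) (c , ℓ<c , hQ) =
    b ℚ.⊓ c , ⊓-glb-< ℓ<b ℓ<c , λ q ℓ<q q<b⊓c →
      hP q ℓ<q (ℚ.<-≤-trans q<b⊓c (ℚ.p⊓q≤p b c)) ,
      hQ q ℓ<q (ℚ.<-≤-trans q<b⊓c (ℚ.p⊓q≤q b c))
  Near-∩ -∞ (b , hP) (c , hQ) =
    b ℚ.⊓ c , λ q q<b⊓c →
      hP q (ℚ.<-≤-trans q<b⊓c (ℚ.p⊓q≤p b c)) ,
      hQ q (ℚ.<-≤-trans q<b⊓c (ℚ.p⊓q≤q b c))

module _ {P : ℚ → Set} where

  Near-universal : ∀ (t : VTerm n) {ys} → (∀ q → P q) → Near t ys P
  Near-universal (exact e) h = h _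
  Near-universal (ℓ +ε)    h = _ , p<p+1 _ , λ q _ _ → h q
  Near-universal -∞        h = 0ℚ , λ q _ → h q

  -- The order of the rationals enters here: density gives a point between `ℓ` and the bound, and
  -- the absence of a least element gives one below any bound.
  Near⇒∃ : ∀ (t : VTerm n) {ys} → Near t ys P → ∃ P
  Near⇒∃ (exact e) Pe = _ , Pe
  Near⇒∃ (ℓ +ε) (b , ℓ<b , h) with ℚ.<-dense ℓ<b
  ... | q , ℓ<q , q<b = q , h q ℓ<q q<b
  Near⇒∃ -∞ (b , h) = b ℚ.- 1ℚ , h _ (p-1<p b)

∈-lowers : ∀ {λₘ : Formula (suc n)} (d : NNF XLiteral λₘ) {ℓ} → (_ , lower ℓ) ∈ lits d → ℓ ∈ lowers d
∈-lowers d = ∈-mapMaybe⁺ _ refl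

∈-equals : ∀ {λₘ : Formula (suc n)} (d : NNF XLiteral λₘ) {e} → (_ , equal e) ∈ lits d → e ∈ equals d
∈-equals d = ∈-mapMaybe⁺ _ refl

module _ {c} {_≼_ : Rel (Term n) c} (O : IsDecTotalOrder _≡_ _≼_) where

  open IsDecTotalOrder O using (_≟_; isTotalOrder)

  private
    totalOrder : TotalOrder _ _ _
    totalOrder = record { isTotalOrder = isTotalOrder }

  infixl 8 _⟨_⟩
  _⟨_⟩ : {φ : Formula (suc n)} → NNF XLiteral φ → VTerm n → Formula n
  d ⟨ t ⟩ = _[_] O d t

  least≡just⇒∈ : ∀ ts {t} → least O ts ≡ just t → t ∈ ts
  least≡just⇒∈ (t ∷ ts) refl = [ here , there ]′ (Extrema.argmin-sel totalOrder id t ts)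

  least≡nothing⇒[] : ∀ ts → least O ts ≡ nothing → ts ≡ []
  least≡nothing⇒[] [] refl = refl

  -- The absent clauses are those where the literal becomes `⊥′`, so that the premise is empty.
  substLit-Near : ∀ {φ} (l : XLiteral φ) t {ys} →
                  ys ⊨ substLit O l t → Near t ys (λ q → q ∷ ys ⊨ φ)
  substLit-Near (free {φ} _) t h = Near-universal t λ q → subst id (sym (⊨↑ φ)) h
  substLit-Near (lower ℓ) (exact e) h = subst (ℚ._< _) (sym (⟦↑ₜ⟧ ℓ)) h
  substLit-Near (upper u) (exact e) h = subst (_ ℚ.<_) (sym (⟦↑ₜ⟧ u)) h
  substLit-Near (equal e′) (exact e) h with e′ ≟ e
  ... | yes refl = sym (⟦↑ₜ⟧ e)
  ... | no  _    = trans h (sym (⟦↑ₜ⟧ e′))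
  substLit-Near (lower ℓ′) (ℓ +ε) h =
    _ , p<p+1 _ , λ q ℓ<q _ → subst (ℚ._< q) (sym (⟦↑ₜ⟧ ℓ′)) (ℚ.≤-<-trans h ℓ<q)
  -- The germ is bounded by the value of `u` itself; `h` says precisely that this value exceeds that
  -- of `ℓ`.
  substLit-Near (upper u) (ℓ +ε) h =
    _ , h , λ q _ → subst (q ℚ.<_) (sym (⟦↑ₜ⟧ u))
  substLit-Near (upper u) -∞ _ = _ , λ q → subst (q ℚ.<_) (sym (⟦↑ₜ⟧ u))

  subst-Near : ∀ {φ} (d : NNF XLiteral φ) t {ys} →
               ys ⊨ d ⟨ t ⟩ → Near t ys (λ q → q ∷ ys ⊨ φ)
  subst-Near true      t h        = Near-universal t λ _ → tt
  subst-Near (lit l)   t h        = substLit-Near l t h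
  subst-Near (d and e) t (h , h′) = Near-∩ t (subst-Near d t h) (subst-Near e t h′)
  subst-Near (d or e)  t (inj₁ h) = Near-map t inj₁ (subst-Near d t h)
  subst-Near (d or e)  t (inj₂ h) = Near-map t inj₂ (subst-Near e t h)

  -- Above the literals only conjunction and disjunction occur, and both are monotone. The premise
  -- is confined to `lits d` because a test point is chosen by looking at these literals alone.
  subst-mono : ∀ {φ} (d : NNF XLiteral φ) t {M ys} →
               (∀ {ψ} (l : XLiteral ψ) → (ψ , l) ∈ lits d → M ⊨ ψ → ys ⊨ substLit O l t) →
               M ⊨ φ → ys ⊨ d ⟨ t ⟩
  subst-mono true      t f h        = tt
  subst-mono (lit l)   t f h        = f l (here refl) h
  subst-mono (d and e) t f (h , h′) =
    subst-mono d t (λ l → f l ∘ ∈-++⁺ˡ) h ,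
    subst-mono e t (λ l → f l ∘ ∈-++⁺ʳ (lits d)) h′
  subst-mono (d or e)  t f (inj₁ h) = inj₁ (subst-mono d t (λ l → f l ∘ ∈-++⁺ˡ) h)
  subst-mono (d or e)  t f (inj₂ h) = inj₂ (subst-mono e t (λ l → f l ∘ ∈-++⁺ʳ (lits d)) h)

  module _ {λₘ : Formula (suc n)} (d : NNF XLiteral λₘ) where

    -- A specification of `testPoint` that forgets how ties are broken: any eligible term is
    -- allowed. The last two constructors also record that the earlier choices failed, which handles
    -- the literals sent to `⊥′`.
    data IsTestPoint (M : Model (suc n)) : VTerm n → Set where
      exact : ∀ {e} → e ∈ equals d → M ⊨ x =′ ↑ₜ e → IsTestPoint M (exact e)
      _+ε   : ∀ {ℓ} → ℓ ∈ lowers d × (M ⊨ ↑ₜ ℓ <′ x) ×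
              All (λ ℓ′ → M ⊨ ↑ₜ ℓ′ <′ x → M ⊨ ↑ₜ ℓ′ ≤′ ↑ₜ ℓ) (lowers d) →
              (∀ {e} → e ∈ equals d → ¬ (M ⊨ x =′ ↑ₜ e)) → IsTestPoint M (ℓ +ε)
      -∞    : (∀ {ℓ} → ℓ ∈ lowers d → ¬ (M ⊨ ↑ₜ ℓ <′ x)) →
              (∀ {e} → e ∈ equals d → ¬ (M ⊨ x =′ ↑ₜ e)) → IsTestPoint M -∞

    -- Among the lower bounds that hold in M, one of greatest value would be eligible.
    eligibleLowers≡[]⇒¬ : ∀ M → eligibleLowers O d M ≡ [] →
                          ∀ {ℓ} → ℓ ∈ lowers d → ¬ (M ⊨ ↑ₜ ℓ <′ x)
    eligibleLowers≡[]⇒¬ M none ℓ∈ ℓ<x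
      with ∃-argmax (λ ℓ → ⟦ ↑ₜ ℓ ⟧ M) (∈-filter⁺ (λ ℓ → M ⊨? ↑ₜ ℓ <′ x) ℓ∈ ℓ<x)
    ... | m , m∈ , bound
      with ∈-filter⁻ (λ ℓ → M ⊨? ↑ₜ ℓ <′ x) {xs = lowers d} m∈
    ... | m∈lowers , m<x = filter≡[]⇒¬ _ none m∈lowers
      (m<x , All.tabulate λ ℓ′∈ ℓ′<x → bound (∈-filter⁺ _ ℓ′∈ ℓ′<x))

    isTestPoint : ∀ M → IsTestPoint M (testPoint O d M)
    isTestPoint M with least O (eligibleEquals O d M) in eq₁ | least O (eligibleLowers O d M) in eq₂
    ... | just e | _ with ∈-filter⁻ _ {xs = equals d} (least≡just⇒∈ _ eq₁)
    ...   | e∈ , x=e = exact e∈ x=e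
    isTestPoint M | nothing | just ℓ =
      (∈-filter⁻ _ {xs = lowers d} (least≡just⇒∈ _ eq₂) +ε)
        (filter≡[]⇒¬ _ (least≡nothing⇒[] _ eq₁))
    isTestPoint M | nothing | nothing =
      -∞ (eligibleLowers≡[]⇒¬ M (least≡nothing⇒[] _ eq₂))
         (filter≡[]⇒¬ _ (least≡nothing⇒[] _ eq₁))

    -- At `exact e` the model gives `x` the value of `e`, so the two can be exchanged. At `ℓ +ε` a
    -- true lower bound is at most `ℓ` by maximality, and a true upper bound gives `ℓ < x < u`. A
    -- literal sent to `⊥′` is false in the model.
    substLit-testPoint : ∀ {q ys t} → IsTestPoint (q ∷ ys) t →
                         ∀ {ψ} (l : XLiteral ψ) → (ψ , l) ∈ lits d → q ∷ ys ⊨ ψ → ys ⊨ substLit O l t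
    substLit-testPoint _ (free {φ} _) _ h = subst id (⊨↑ φ) h
    substLit-testPoint (exact {e} _ x=e) (lower ℓ) _ h =
      subst id (⊨↑ (ℓ <′ e)) (subst (_ ℚ.<_) x=e h)
    substLit-testPoint (exact {e} _ x=e) (upper u) _ h =
      subst id (⊨↑ (e <′ u)) (subst (ℚ._< _) x=e h)
    substLit-testPoint (exact {e} _ x=e) (equal e′) _ h with e′ ≟ e
    ... | yes _ = tt
    ... | no  _ = subst id (⊨↑ (e =′ e′)) (trans (sym x=e) h)
    substLit-testPoint ((_+ε {ℓ}) (_ , _ , greatest) _) (lower ℓ′) l∈ h =
      subst id (⊨↑ (ℓ′ ≤′ ℓ)) (All.lookup greatest (∈-lowers d l∈) h)
    substLit-testPoint ((_+ε {ℓ}) (_ , ℓ<x , _) _) (upper u) _ h =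
      subst id (⊨↑ (ℓ <′ u)) (ℚ.<-trans ℓ<x h)
    substLit-testPoint ((_ +ε) ¬eq) (equal e) l∈ h = ¬eq (∈-equals d l∈) h
    substLit-testPoint (-∞ ¬lower _) (lower ℓ) l∈ h = ¬lower (∈-lowers d l∈) h
    substLit-testPoint (-∞ _ _)      (upper u) _  _ = tt
    substLit-testPoint (-∞ _ ¬eq)    (equal e) l∈ h = ¬eq (∈-equals d l∈) h

    -- This list depends on `d` but on no model, and every projection is `d ⟨ t ⟩` for some `t` in
    -- it; hence the finite image.
    testPoints : List (VTerm n)
    testPoints = -∞ ∷ map exact (equals d) ++ map _+ε (lowers d)

    isTestPoint⇒∈ : ∀ {M t} → IsTestPoint M t → t ∈ testPoints
    isTestPoint⇒∈ (exact e∈ _)      = there (∈-++⁺ˡ (∈-map⁺ exact e∈))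
    isTestPoint⇒∈ (((ℓ∈ , _) +ε) _) = there (∈-++⁺ʳ (map exact (equals d)) (∈-map⁺ _+ε ℓ∈))
    isTestPoint⇒∈ (-∞ _ _)          = here refl

theorem4 : ∀ {c : Level} (n : ℕ) {_≼_ : Rel (Term n) c}
    (O : IsDecTotalOrder _≡_ _≼_)
    (λₘ : Formula (suc n)) (d : NNF XLiteral λₘ) →
    IsMBP {1} {n} λₘ (LRAProj O d)
theorem4 n O λₘ d = record
  { finite-image = map (_⟨_⟩ O d) (testPoints O d) , λ where
      (q ∷ []) ys _ → ∈-map⁺ (_⟨_⟩ O d) (isTestPoint⇒∈ O d (isTestPoint O d (q ∷ ys)))
  ; equivalent = λ ys → mk⇔
      (λ where (xs , h) → xs , ys , h , satisfied xs ys h)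
      (λ where
        (xs′ , ys′ , _ , h) →
          -- Here `t` comes from a model over `ys′`, whereas `h` holds at `ys`. The two need not
          -- agree: `subst-Near` applies to any virtual term at any valuation.
          let t      = testPoint O d (xs′ Vec.++ ys′)
              q , h′ = Near⇒∃ t (subst-Near O d t h)
          in q ∷ [] , h′)
  ; satisfied = satisfied
  }
  where
  satisfied : ∀ xs ys (h : xs Vec.++ ys ⊨ λₘ) → ys ⊨ LRAProj O d xs ys h
  satisfied (q ∷ []) ys h =
    subst-mono O d _ (substLit-testPoint O d (isTestPoint O d (q ∷ ys))) h
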